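{- Let $I$ be a finite set and let $\mathrm{Ev}_I\subseteq\{0,1\}^I$ be the set of binary strings containing an even number of $1$'s. A simplicial complex over $I$ generates $\mathrm{Ev}_I$ if and only if it is connected. Therefore, the minimal complexes generating $\mathrm{Ev}_I$ are the trees spanning $I$.
   Context: All sets are finite. For $f:B^J\to A^I$ write $f_i(x)=f(x)_i$. For $i\in I$, the input window $\mathcal{W}_f(i)$ is the smallest set $W\subseteq J$ (it exists) such that for all $x,y\in B^J$, $x|_W=y|_W$ implies $f_i(x)=f_i(y)$. A simplicial complex (or complex) over a set $I$ is a collection of subsets of $I$, called its simplices, that is closed under taking subsets. The communication complex $K_f$ of $f$ is the complex over $I$ defined, for $S\subseteq I$, by: $S\in K_f$ iff $\bigcap_{i\in S}\mathcal{W}_f(i)\neq\emptyset$ (for $S=\emptyset$ the intersection is $J$). A complex $K$ over $I$ generates a language $L\subseteq A^I$ if there exist finite sets $B,J$ and a function $f:B^J\to A^I$ with image exactly $L$ and $K_f\subseteq K$. A complex generating $L$ is minimal if no complex strictly contained in it generates $L$. A complex over $I$ is disconnected if there is a partition $I=I_0\sqcup I_1$ into two non-empty sets such that every simplex is contained in $I_0$ or in $I_1$; otherwise it is connected. A tree spanning $I$ is a tree with vertex set $I$, regarded as a complex whose simplices are its vertices and edges (and the empty set).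
   Formalization: The second sentence (minimal complexes are the spanning trees) is stated for |I| ≥ 2: for |I| ≤ 1 it fails, since a constant function with J empty generates Ev_I with no simplices at all, so the minimal complex is the void collection and not a tree. -}

module Defs where

open import Level using (0ℓ)
open import Data.Nat using (ℕ; zero; suc; _≤_)
open import Data.Nat.Divisibility using (_∣_)
open import Data.Fin using (Fin; zero; suc)
open import Data.Fin.Properties using (_≟_; all?; any?)
open import Data.Fin.Subset
  using (Subset; ⊤; ⊥; ⁅_⁆; ∁; _∩_; _∪_; Nonempty)
  renaming (_∈_ to _∈ˢ_; _⊆_ to _⊆ˢ_; _⊂_ to _⊂ˢ_)
open import Data.Fin.Subset.Properties
  using (anySubset?; _∈?_; _⊆?_; ∈⊤; x∈⁅y⁆⇒x≡y; x∈p∪q⁻; x∈p∩q⁺; x∈p∩q⁻;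
         ⊆-antisym; ⊥⊆)
open import Data.Fin.Subset.Induction using (⊂-wellFounded; Acc; acc)
open import Data.Bool.Properties using () renaming (_≟_ to _≟ᵇ_)
open import Data.List.Base using (List; []; _∷_; _∷ʳ_; length)
open import Data.List.Relation.Unary.Linked using (Linked)
open import Data.List.Relation.Unary.Unique.Propositional using (Unique)
open import Data.Vec.Base using (Vec; []; _∷_; lookup; tabulate; count)
open import Data.Vec.Properties using (lookup∘tabulate; ≡-dec)
open import Data.Vec.Relation.Binary.Pointwise.Extensional using (ext; Pointwise-≡⇒≡)
open import Data.Product using (∃; ∃₂; _×_; _,_; proj₁; proj₂)
open import Data.Sum using (_⊎_; inj₁; inj₂)
import Data.Empty as Empty
open import Relation.Nullary using (¬_; Dec; yes; no; contradiction)
open import Relation.Nullary.Decidable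
  using (map′; _×-dec_; _⊎-dec_; _→-dec_; ¬?; decidable-stable)
open import Relation.Unary using (Pred; Decidable; _⊆_; _⊂_; _≐_)
import Relation.Binary as B
open import Relation.Binary.Construct.Closure.ReflexiveTransitive using (Star)
open import Relation.Binary.PropositionalEquality
  using (_≡_; refl; sym; trans; cong; subst)

-- Finite sets are represented by initial segments: I = Fin n, J = Fin m,
-- B = Fin b, A = Fin a.  The power X^I is Vec X n, so that equality in X^I is
-- pointwise equality.

------------------------------------------------------------------------
-- Simplicial complexes

-- All sets being finite, a collection of subsets is a decidable predicate.
-- Neither the vertices nor even the empty set are required to be simplices.
record Complex (n : ℕ) : Set₁ where
  field
    Simplex  : Pred (Subset n) 0ℓ
    simplex? : Decidable Simplex
    down     : ∀ {S T} → S ⊆ˢ T → Simplex T → Simplex S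

open Complex public

module _ {n : ℕ} where

  infix 4 _⊆ᶜ_ _⊂ᶜ_ _≐ᶜ_

  _⊆ᶜ_ _⊂ᶜ_ _≐ᶜ_ : Complex n → Complex n → Set
  K ⊆ᶜ L = Simplex K ⊆ Simplex L
  K ⊂ᶜ L = Simplex K ⊂ Simplex L
  K ≐ᶜ L = Simplex K ≐ Simplex L

  Disconnected : Complex n → Set
  Disconnected K = ∃ λ (I₀ : Subset n) → Nonempty I₀ × Nonempty (∁ I₀) ×
    (∀ S → Simplex K S → S ⊆ˢ I₀ ⊎ S ⊆ˢ ∁ I₀)

  Connected : Complex n → Set
  Connected K = ¬ Disconnected K

------------------------------------------------------------------------
-- Input windows

Smallest : ∀ {m} → Pred (Subset m) 0ℓ → Pred (Subset m) 0ℓ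
Smallest P W = P W × (∀ W′ → P W′ → W ⊆ˢ W′)

smallest-exists : ∀ {m} {P : Pred (Subset m) 0ℓ} → Decidable P → P ⊤ →
                  (∀ {V W} → P V → P W → P (V ∩ W)) → ∃ (Smallest P)
smallest-exists {m} {P} P? P⊤ P∩ = descend ⊤ P⊤ (⊂-wellFounded ⊤)
  where
  escape : ∀ W W′ → ¬ (W ⊆ˢ W′) → W ∩ W′ ⊂ˢ W
  escape W W′ W⊈W′ with any? (λ j → (j ∈? W) ×-dec ¬? (j ∈? W′))
  ... | yes (j , j∈W , j∉W′) =
    (λ i∈ → proj₁ (x∈p∩q⁻ W W′ i∈)) , j , j∈W , λ j∈ → j∉W′ (proj₂ (x∈p∩q⁻ W W′ j∈))
  ... | no none = contradiction
    (λ {j} j∈W → decidable-stable (j ∈? W′) (λ j∉W′ → none (j , j∈W , j∉W′))) W⊈W′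

  descend : ∀ W → P W → Acc _⊂ˢ_ W → ∃ (Smallest P)
  descend W PW (acc rec) with anySubset? (λ W′ → P? W′ ×-dec ¬? (W ⊆? W′))
  ... | yes (W′ , PW′ , W⊈W′) = descend (W ∩ W′) (P∩ PW PW′) (rec (escape W W′ W⊈W′))
  ... | no none = W , PW , λ W′ PW′ →
    decidable-stable (W ⊆? W′) (λ W⊈W′ → none (W′ , PW′ , W⊈W′))

allVec? : ∀ {b m} {P : Pred (Vec (Fin b) m) 0ℓ} → Decidable P → Dec (∀ x → P x)
allVec? {m = zero}  P? = map′ (λ { p [] → p }) (λ p → p []) (P? [])
allVec? {m = suc _} P? =
  map′ (λ { p (c ∷ x) → p c x }) (λ p c x → p (c ∷ x))
       (all? (λ c → allVec? (λ x → P? (c ∷ x))))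

module _ {b m : ℕ} where

  Agree : Subset m → Vec (Fin b) m → Vec (Fin b) m → Set
  Agree W x y = ∀ j → j ∈ˢ W → lookup x j ≡ lookup y j

  agree? : ∀ W x y → Dec (Agree W x y)
  agree? W x y = all? (λ j → (j ∈? W) →-dec (lookup x j ≟ lookup y j))

module _ {b m a n : ℕ} (f : Vec (Fin b) m → Vec (Fin a) n) where

  Determines : Fin n → Pred (Subset m) 0ℓ
  Determines i W = ∀ x y → Agree W x y → lookup (f x) i ≡ lookup (f y) i

  determines? : ∀ i → Decidable (Determines i)
  determines? i W =
    allVec? λ x → allVec? λ y → agree? W x y →-dec (lookup (f x) i ≟ lookup (f y) i)

  determines-⊤ : ∀ i → Determines i ⊤
  determines-⊤ i x y x≈y =
    cong (λ z → lookup (f z) i) (Pointwise-≡⇒≡ (ext (λ j → x≈y j ∈⊤)))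

  determines-∩ : ∀ i {V W} → Determines i V → Determines i W → Determines i (V ∩ W)
  determines-∩ i {V} {W} dV dW x y x≈y = trans (dV x z x≈z) (dW z y z≈y)
    where
    pick : ∀ j → Dec (j ∈ˢ V) → Fin b
    pick j (yes _) = lookup x j
    pick j (no _)  = lookup y j

    z : Vec (Fin b) m
    z = tabulate (λ j → pick j (j ∈? V))

    pick-V : ∀ j d → j ∈ˢ V → lookup x j ≡ pick j d
    pick-V j (yes _)  _   = refl
    pick-V j (no j∉V) j∈V = contradiction j∈V j∉V

    pick-W : ∀ j d → j ∈ˢ W → pick j d ≡ lookup y j
    pick-W j (yes j∈V) j∈W = x≈y j (x∈p∩q⁺ (j∈V , j∈W))
    pick-W j (no _)    _   = refl

    x≈z : Agree V x z
    x≈z j j∈V = trans (pick-V j (j ∈? V) j∈V) (sym (lookup∘tabulate _ j))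

    z≈y : Agree W z y
    z≈y j j∈W = trans (lookup∘tabulate _ j) (pick-W j (j ∈? V) j∈W)

  inputWindow-exists : ∀ i → ∃ (Smallest (Determines i))
  inputWindow-exists i =
    smallest-exists (determines? i) (determines-⊤ i) (determines-∩ i)

  inputWindow : Fin n → Subset m
  inputWindow i = proj₁ (inputWindow-exists i)

  inputWindow-smallest : ∀ i → Smallest (Determines i) (inputWindow i)
  inputWindow-smallest i = proj₂ (inputWindow-exists i)

------------------------------------------------------------------------
-- Communication complexes and generation of languages

  -- For S = ∅ the condition says that J = Fin m is non-empty.
  communicationComplex : Complex n
  communicationComplex = record
    { Simplex  = λ S → ∃ λ j → ∀ i → i ∈ˢ S → j ∈ˢ inputWindow i
    ; simplex? = λ S → any? λ j → all? λ i → (i ∈? S) →-dec (j ∈? inputWindow i)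
    ; down     = λ S⊆T (j , j∈) → j , λ i i∈S → j∈ i (S⊆T i∈S)
    }

  Image : Pred (Vec (Fin a) n) 0ℓ
  Image y = ∃ λ x → f x ≡ y

Language : ℕ → ℕ → Set₁
Language a n = Pred (Vec (Fin a) n) 0ℓ

module _ {a n : ℕ} where

  Generates : Complex n → Language a n → Set
  Generates K L = ∃₂ λ b m → ∃ λ (f : Vec (Fin b) m → Vec (Fin a) n) →
    Image f ≐ L × communicationComplex f ⊆ᶜ K

  MinimalGenerating : Complex n → Language a n → Set₁
  MinimalGenerating K L = Generates K L × (∀ K′ → K′ ⊂ᶜ K → ¬ Generates K′ L)

Ev : ∀ n → Language 2 n
Ev n x = 2 ∣ count (_≟ suc zero) x

------------------------------------------------------------------------
-- Trees

record Graph (n : ℕ) : Set₁ where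
  field
    Adj    : B.Rel (Fin n) 0ℓ
    adj?   : B.Decidable Adj
    irrefl : ∀ {v} → ¬ Adj v v
    symm   : ∀ {u v} → Adj u v → Adj v u

open Graph public

module _ {n : ℕ} (G : Graph n) where

  -- v ∷ vs lists the vertices of a cycle in order; v is repeated at the end
  -- to close it up.
  IsCycle : List (Fin n) → Set
  IsCycle []       = Empty.⊥
  IsCycle (v ∷ vs) = 3 ≤ length (v ∷ vs) × Unique (v ∷ vs) × Linked (Adj G) (v ∷ vs ∷ʳ v)

  IsTree : Set
  IsTree = (∀ u v → Star (Adj G) u v) × (∀ vs → ¬ IsCycle vs)

  data GraphSimplex : Pred (Subset n) 0ℓ where
    empty  : GraphSimplex ⊥
    vertex : ∀ v → GraphSimplex ⁅ v ⁆
    edge   : ∀ {u v} → Adj G u v → GraphSimplex (⁅ u ⁆ ∪ ⁅ v ⁆)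

  graphSimplex? : Decidable GraphSimplex
  graphSimplex? S = map′ to from
    ((S ≟ˢ ⊥) ⊎-dec any? (λ v → S ≟ˢ ⁅ v ⁆) ⊎-dec
     any? (λ u → any? (λ v → adj? G u v ×-dec (S ≟ˢ (⁅ u ⁆ ∪ ⁅ v ⁆)))))
    where
    _≟ˢ_ : (S T : Subset n) → Dec (S ≡ T)
    _≟ˢ_ = ≡-dec _≟ᵇ_

    Cases : Set
    Cases = S ≡ ⊥ ⊎ (∃ λ v → S ≡ ⁅ v ⁆) ⊎
            (∃ λ u → ∃ λ v → Adj G u v × S ≡ ⁅ u ⁆ ∪ ⁅ v ⁆)

    to : Cases → GraphSimplex S
    to (inj₁ refl)                       = empty
    to (inj₂ (inj₁ (v , refl)))          = vertex v
    to (inj₂ (inj₂ (u , v , uv , refl))) = edge uv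

    from : GraphSimplex S → Cases
    from empty      = inj₁ refl
    from (vertex v) = inj₂ (inj₁ (v , refl))
    from (edge uv)  = inj₂ (inj₂ (_ , _ , uv , refl))

  graphSimplex-⊆⁅⁆ : ∀ {S} v → S ⊆ˢ ⁅ v ⁆ → GraphSimplex S
  graphSimplex-⊆⁅⁆ {S} v S⊆ with v ∈? S
  ... | yes v∈S = subst GraphSimplex (⊆-antisym ⁅v⁆⊆S S⊆) (vertex v)
    where
    ⁅v⁆⊆S : ⁅ v ⁆ ⊆ˢ S
    ⁅v⁆⊆S x∈ = subst (_∈ˢ S) (sym (x∈⁅y⁆⇒x≡y v x∈)) v∈S
  ... | no v∉S = subst GraphSimplex (⊆-antisym ⊥⊆ S⊆⊥) empty
    where
    S⊆⊥ : S ⊆ˢ ⊥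
    S⊆⊥ x∈S = contradiction (subst (_∈ˢ S) (x∈⁅y⁆⇒x≡y v (S⊆ x∈S)) x∈S) v∉S

  graphSimplex-down : ∀ {S T} → S ⊆ˢ T → GraphSimplex T → GraphSimplex S
  graphSimplex-down S⊆ empty =
    subst GraphSimplex (⊆-antisym ⊥⊆ S⊆) empty
  graphSimplex-down S⊆ (vertex v) = graphSimplex-⊆⁅⁆ v S⊆
  graphSimplex-down {S} S⊆ (edge {u} {v} uv) with u ∈? S | v ∈? S
  ... | yes u∈S | yes v∈S = subst GraphSimplex (⊆-antisym uv⊆S S⊆) (edge uv)
    where
    uv⊆S : ⁅ u ⁆ ∪ ⁅ v ⁆ ⊆ˢ S
    uv⊆S x∈ with x∈p∪q⁻ ⁅ u ⁆ ⁅ v ⁆ x∈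
    ... | inj₁ x∈u = subst (_∈ˢ S) (sym (x∈⁅y⁆⇒x≡y u x∈u)) u∈S
    ... | inj₂ x∈v = subst (_∈ˢ S) (sym (x∈⁅y⁆⇒x≡y v x∈v)) v∈S
  ... | no u∉S | _ = graphSimplex-⊆⁅⁆ v S⊆v
    where
    S⊆v : S ⊆ˢ ⁅ v ⁆
    S⊆v x∈S with x∈p∪q⁻ ⁅ u ⁆ ⁅ v ⁆ (S⊆ x∈S)
    ... | inj₁ x∈u = contradiction (subst (_∈ˢ S) (x∈⁅y⁆⇒x≡y u x∈u) x∈S) u∉S
    ... | inj₂ x∈v = x∈v
  ... | yes _ | no v∉S = graphSimplex-⊆⁅⁆ u S⊆u
    where
    S⊆u : S ⊆ˢ ⁅ u ⁆
    S⊆u x∈S with x∈p∪q⁻ ⁅ u ⁆ ⁅ v ⁆ (S⊆ x∈S)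
    ... | inj₁ x∈u = x∈u
    ... | inj₂ x∈v = contradiction (subst (_∈ˢ S) (x∈⁅y⁆⇒x≡y v x∈v) x∈S) v∉S

  graphComplex : Complex n
  graphComplex = record
    { Simplex  = GraphSimplex
    ; simplex? = graphSimplex?
    ; down     = graphSimplex-down
    }

IsSpanningTree : ∀ {n} → Complex n → Set₁
IsSpanningTree {n} K = ∃ λ (G : Graph n) → IsTree G × K ≐ᶜ graphComplex G

{-# OPTIONS --safe #-}

-- If K is connected, so is its graph of edges, and f sends a set x of edges
-- (one binary input per edge) to its mod-2 boundary: the vertices of odd degree.
-- The input at an edge is read by its two end points only, boundaries are even,
-- and adding a path from u to v flips the outputs at u and v, which is enough to
-- reach every even string.
-- Conversely, if K is split into I₀ and its complement, the windows of the two
-- parts are disjoint, so preimages of two even strings can be glued along I₀;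
-- for 0 and the indicator of {a, b} with a ∈ I₀ ∌ b the output has a single 1.
-- A minimal connected complex then consists of its edges and has no cycle, since
-- an edge of a cycle could be deleted.
module Submission where

open import Defs
open import Data.Bool.Properties using () renaming (_≟_ to _≟ᵇ_)
open import Data.Fin using (Fin; zero; suc; opposite)
open import Data.Fin.Properties using (_≟_; any?)
open import Data.Fin.Subset
  using (Subset; ⁅_⁆; ∁; _∪_; _∈_; _∉_; _⊆_; _⊃_; inside)
open import Data.Fin.Subset.Induction using (⊃-wellFounded)
open import Data.Fin.Subset.Properties
  using (_∈?_; x∈⁅x⁆; x∈⁅y⁆⇒x≡y; x∈p∪q⁺; x∈p∪q⁻; p⊆p∪q; ∪-comm; ∉⊥; ⊥⊆;
         x∉p⇒x∈∁p; x∈∁p⇒x∉p)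
open import Data.List.Base
  using (List; []; _∷_; _∷ʳ_; length; filter; allFin; cartesianProduct)
import Data.List.Base as List
open import Data.List.Membership.DecPropositional using () renaming (_∈?_ to ∈ˡ?)
open import Data.List.Membership.Propositional using () renaming (_∈_ to _∈ˡ_)
open import Data.List.Membership.Propositional.Properties
  using (∈-filter⁺; ∈-filter⁻; ∈-cartesianProduct⁺; ∈-allFin; ∈-lookup)
open import Data.List.Relation.Unary.All as All using (All; []; _∷_)
open import Data.List.Relation.Unary.All.Properties using (¬Any⇒All¬)
open import Data.List.Relation.Unary.AllPairs using ([]; _∷_)
open import Data.List.Relation.Unary.Any using (here; there)
open import Data.List.Relation.Unary.Linked using (Linked; []; [-]; _∷_)
open import Data.List.Relation.Unary.Unique.Propositional using (Unique)
open import Data.Nat using (ℕ; zero; suc; _≤_; z≤n; s≤s; parity)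
open import Data.Nat.Divisibility using (_∣_; _∣0; ∣m+n∣m⇒∣n; ∣m∣n⇒∣m+n; ∣-refl; ∣1⇒≡1)
open import Data.Parity using (0ℙ; _⁻¹)
open import Data.Parity.Properties using (⁻¹-involutive; suc-homo-⁻¹; p≢p⁻¹)
open import Data.Product using (∃; _×_; _,_; proj₁; proj₂)
open import Data.Sum using (_⊎_; inj₁; inj₂; [_,_]′)
open import Data.Vec.Base
  using (Vec; []; _∷_; lookup; tabulate; count; updateAt; replicate; here; there)
open import Data.Vec.Properties
  using (updateAt-updateAt; updateAt-id-local; updateAt-commutes; lookup∘updateAt;
         lookup∘updateAt′; lookup∘tabulate; ≡-dec; []=⇒lookup;
         lookup⇒[]=)
open import Data.Vec.Relation.Binary.Pointwise.Extensional using (ext; Pointwise-≡⇒≡)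
open import Function using (_∘_)
open import Function.Bundles using (_⇔_; mk⇔)
open import Induction.WellFounded using (Acc; acc)
open import Relation.Binary using (Rel; Decidable)
open import Relation.Binary.Construct.Closure.ReflexiveTransitive as Star
  using (Star; ε; _◅_; _⋆)
open import Relation.Binary.PropositionalEquality
  using (_≡_; _≢_; refl; sym; trans; cong; subst)
open import Relation.Nullary using (¬_; Dec; yes; no; contradiction; does)
open import Relation.Nullary.Decidable
  using (_×-dec_; _⊎-dec_; dec-true; ¬?; decidable-stable)
open import Relation.Unary using (Pred)
open import Level using (0ℓ)

-- Flipping entries of binary strings

module _ {n : ℕ} where

  flip : Fin n → Vec (Fin 2) n → Vec (Fin 2) n
  flip i y = updateAt y i opposite

  flip-involutive : ∀ i y → flip i (flip i y) ≡ y
  flip-involutive i y =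
    trans (updateAt-updateAt i y) (updateAt-id-local i y (opposite² (lookup y i)))
    where
    opposite² : (c : Fin 2) → opposite (opposite c) ≡ c
    opposite² zero       = refl
    opposite² (suc zero) = refl

  flip-comm : ∀ i j y → flip i (flip j y) ≡ flip j (flip i y)
  flip-comm i j y with i ≟ j
  ... | yes refl = refl
  ... | no i≢j   = updateAt-commutes i j i≢j y

  flip-cong : ∀ {i} j x y → lookup x i ≡ lookup y i →
              lookup (flip j x) i ≡ lookup (flip j y) i
  flip-cong {i} j x y eq with i ≟ j
  ... | yes refl = trans (lookup∘updateAt i x) (trans (cong opposite eq) (sym (lookup∘updateAt i y)))
  ... | no i≢j   = trans (lookup∘updateAt′ i j i≢j x) (trans eq (sym (lookup∘updateAt′ i j i≢j y)))

  -- For `u` equal to `v` the two flips cancel, so a degenerate pair acts as the identity.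
  flip² : Fin n × Fin n → Vec (Fin 2) n → Vec (Fin 2) n
  flip² (u , v) y = flip u (flip v y)

  flip²-involutive : ∀ e y → flip² e (flip² e y) ≡ y
  flip²-involutive (u , v) y =
    trans (cong (flip u) (trans (cong (flip v) (flip-comm u v y)) (flip-involutive v (flip u y))))
          (flip-involutive u y)

  flip²-comm : ∀ d e y → flip² d (flip² e y) ≡ flip² e (flip² d y)
  flip²-comm (s , t) (u , v) y = trans (cong (flip s) (past t y)) (past s (flip t y))
    where
    past : ∀ r z → flip r (flip u (flip v z)) ≡ flip u (flip v (flip r z))
    past r z = trans (flip-comm r u (flip v z)) (cong (flip u) (flip-comm r v z))

-- Parity, and the strings reached by flipping pairs

ones : ∀ {n} → Vec (Fin 2) n → ℕ
ones = count (_≟ suc zero)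

2∣⇒parity : ∀ k → 2 ∣ k → parity k ≡ 0ℙ
2∣⇒parity zero          _     = refl
2∣⇒parity (suc zero)    2∣1   = contradiction (∣1⇒≡1 2∣1) λ ()
2∣⇒parity (suc (suc k)) 2∣2+k = 2∣⇒parity k (∣m+n∣m⇒∣n 2∣2+k ∣-refl)

parity⇒2∣ : ∀ k → parity k ≡ 0ℙ → 2 ∣ k
parity⇒2∣ zero          _  = 2 ∣0
parity⇒2∣ (suc (suc k)) eq = ∣m∣n⇒∣m+n ∣-refl (parity⇒2∣ k eq)

parity-suc : ∀ k → parity (suc k) ≡ parity k ⁻¹
parity-suc k = trans (sym (⁻¹-involutive (parity (suc k)))) (cong _⁻¹ (suc-homo-⁻¹ k))

-- A flip adds or removes a single one, and either change inverts the parity.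
parity-flip : ∀ {n} i (y : Vec (Fin 2) n) → parity (ones (flip i y)) ≡ parity (ones y) ⁻¹
parity-flip zero    (zero ∷ y)     = parity-suc (ones y)
parity-flip zero    (suc zero ∷ y) = sym (suc-homo-⁻¹ (ones y))
parity-flip (suc i) (zero ∷ y)     = parity-flip i y
parity-flip (suc i) (suc zero ∷ y) =
  trans (parity-suc (ones (flip i y)))
        (cong _⁻¹ (trans (parity-flip i y) (sym (parity-suc (ones y)))))

module _ {n : ℕ} where

  Ev-flip² : ∀ e y → Ev n y → Ev n (flip² e y)
  Ev-flip² (u , v) y even = parity⇒2∣ (ones (flip u (flip v y)))
    (trans (parity-flip u (flip v y))
    (trans (cong _⁻¹ (parity-flip v y))
    (trans (⁻¹-involutive (parity (ones y))) (2∣⇒parity (ones y) even))))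

  ¬Ev-flip : ∀ i y → Ev n y → ¬ Ev n (flip i y)
  ¬Ev-flip i y even even′ = p≢p⁻¹ 0ℙ (sym
    (trans (cong _⁻¹ (sym (2∣⇒parity (ones y) even)))
    (trans (sym (parity-flip i y)) (2∣⇒parity (ones (flip i y)) even′))))

Ev-zeros : ∀ n → Ev n (replicate n zero)
Ev-zeros n = subst (2 ∣_) (sym (ones-zeros n)) (2 ∣0)
  where
  ones-zeros : ∀ n → ones (replicate n zero) ≡ 0
  ones-zeros zero    = refl
  ones-zeros (suc n) = ones-zeros n

-- Different heads would make the two strings differ by one flip, which `¬Ev-flip` excludes.
Ev-head-unique : ∀ {n} c d (y : Vec (Fin 2) n) → Ev (suc n) (c ∷ y) → Ev (suc n) (d ∷ y) → c ≡ d
Ev-head-unique zero       zero       y _  _  = refl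
Ev-head-unique (suc zero) (suc zero) y _  _  = refl
Ev-head-unique zero       (suc zero) y ev ev′ = contradiction ev′ (¬Ev-flip zero (zero ∷ y) ev)
Ev-head-unique (suc zero) zero       y ev ev′ = contradiction ev (¬Ev-flip zero (zero ∷ y) ev′)

-- The first argument of `Q` is a bit that every flip of the string inverts too. The entries behind
-- the first are built with the first kept at zero; at most one more flip then sets it, and the
-- final bit is whatever results.
flips-reach-tail : ∀ {n} (Q : Fin 2 → Vec (Fin 2) n → Set) → Q zero (replicate n zero) →
                   (∀ i {c y} → Q c y → Q (opposite c) (flip i y)) → ∀ y → ∃ λ c → Q c y
flips-reach-tail Q q₀ step []      = zero , q₀
flips-reach-tail Q q₀ step (d ∷ y)
  with flips-reach-tail (λ c z → Q c (zero ∷ z)) q₀ (λ i → step (suc i)) y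
flips-reach-tail Q q₀ step (zero ∷ y)     | c , q = c , q
flips-reach-tail Q q₀ step (suc zero ∷ y) | c , q = opposite c , step zero q

flips-generate-Ev : ∀ {n} (Q : Pred (Vec (Fin 2) n) 0ℓ) → Q (replicate n zero) →
                    (∀ e {y} → Q y → Q (flip² e y)) → ∀ y → Ev n y → Q y
flips-generate-Ev {zero}  Q q₀ step []      even = q₀
flips-generate-Ev {suc n} Q q₀ step (c ∷ y) even
  -- The pairs `(zero , suc i)` bring the tail to `y`. Evenness is carried along because it then
  -- forces the head.
  with flips-reach-tail (λ d z → Q (d ∷ z) × Ev (suc n) (d ∷ z)) (q₀ , Ev-zeros (suc n))
         (λ { i {d} {z} (q , ev) →
              step (zero , suc i) q , Ev-flip² (zero , suc i) (d ∷ z) ev }) y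
... | d , q , ev = subst (λ b → Q (b ∷ y)) (Ev-head-unique d c y ev even) q

-- Boundaries of edge sets

module _ {n : ℕ} where

  flip²-if : Fin 2 → Fin n × Fin n → Vec (Fin 2) n → Vec (Fin 2) n
  flip²-if zero       e y = y
  flip²-if (suc zero) e y = flip² e y

  boundary : (es : List (Fin n × Fin n)) → Vec (Fin 2) (length es) → Vec (Fin 2) n
  boundary []       []      = replicate n zero
  boundary (e ∷ es) (c ∷ x) = flip²-if c e (boundary es x)

  boundary-zeros : ∀ es → boundary es (replicate _ zero) ≡ replicate n zero
  boundary-zeros []       = refl
  boundary-zeros (e ∷ es) = boundary-zeros es

  boundary-Ev : ∀ es x → Ev n (boundary es x)
  boundary-Ev []       []             = Ev-zeros n
  boundary-Ev (e ∷ es) (zero ∷ x)     = boundary-Ev es x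
  boundary-Ev (e ∷ es) (suc zero ∷ x) = Ev-flip² e (boundary es x) (boundary-Ev es x)

  -- Toggle the input at `e`: if it was set, the two flips cancel by involutivity, and the flips of
  -- edges listed before `e` commute with `flip² e`.
  boundary-flip² : ∀ {e es} → e ∈ˡ es → ∀ x → Image (boundary es) (flip² e (boundary es x))
  boundary-flip² (here refl) (zero ∷ x)     = suc zero ∷ x , refl
  boundary-flip² (here refl) (suc zero ∷ x) = zero ∷ x , sym (flip²-involutive _ _)
  boundary-flip² (there e∈)  (zero ∷ x) with boundary-flip² e∈ x
  ... | x′ , eq = zero ∷ x′ , eq
  boundary-flip² {e} (there {d} e∈) (suc zero ∷ x) with boundary-flip² e∈ x
  ... | x′ , eq = suc zero ∷ x′ , trans (cong (flip² d) eq) (flip²-comm d e _)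

  Incident : Fin n → Fin n × Fin n → Set
  Incident i (u , v) = i ≡ u ⊎ i ≡ v

  incident? : ∀ i e → Dec (Incident i e)
  incident? i (u , v) = (i ≟ u) ⊎-dec (i ≟ v)

  star : Fin n → (es : List (Fin n × Fin n)) → Subset (length es)
  star i []       = []
  star i (e ∷ es) = does (incident? i e) ∷ star i es

  star⇒incident : ∀ {i} es {j} → j ∈ star i es → Incident i (List.lookup es j)
  star⇒incident {i} (e ∷ es) {zero} j∈ = witness (incident? i e) ([]=⇒lookup j∈)
    where
    witness : ∀ {P : Set} (P? : Dec P) → does P? ≡ inside → P
    witness (yes p) _ = p
  star⇒incident (e ∷ es) {suc j} (there j∈) = star⇒incident es j∈

  -- An edge away from `i` leaves entry `i` alone whatever its input, and at an edge incident to `i`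
  -- the two inputs agree. Hence the input window of `i` lies inside `star i es`.
  star-determines : ∀ i es → Determines (boundary es) i (star i es)
  star-determines i []       []      []      _   = refl
  star-determines i (e ∷ es) (c ∷ x) (d ∷ y) x≈y with incident? i e
  ... | yes inc with refl ← x≈y zero (lookup⇒[]= zero _ (dec-true (incident? i e) inc)) =
    flip²-if-cong c e (boundary es x) (boundary es y)
      (star-determines i es x y (λ j j∈ → x≈y (suc j) (there j∈)))
    where
    flip²-if-cong : ∀ c e x y → lookup x i ≡ lookup y i →
                    lookup (flip²-if c e x) i ≡ lookup (flip²-if c e y) i
    flip²-if-cong zero       _       x y eq = eq
    flip²-if-cong (suc zero) (u , v) x y eq =
      flip-cong u (flip v x) (flip v y) (flip-cong v x y eq)
  ... | no ¬inc = trans (unchanged c e ¬inc _)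
    (trans (star-determines i es x y (λ j j∈ → x≈y (suc j) (there j∈)))
           (sym (unchanged d e ¬inc _)))
    where
    unchanged : ∀ c e → ¬ Incident i e → ∀ y → lookup (flip²-if c e y) i ≡ lookup y i
    unchanged zero       _       _    y = refl
    unchanged (suc zero) (u , v) ¬inc y =
      trans (lookup∘updateAt′ i u (¬inc ∘ inj₁) (flip v y))
            (lookup∘updateAt′ i v (¬inc ∘ inj₂) y)

-- Pairs of vertices and the graph of edges of a complex

module _ {n : ℕ} where

  pair : Fin n → Fin n → Subset n
  pair u v = ⁅ u ⁆ ∪ ⁅ v ⁆

  ∈pairˡ : ∀ u v → u ∈ pair u v
  ∈pairˡ u v = x∈p∪q⁺ (inj₁ (x∈⁅x⁆ u))

  ∈pairʳ : ∀ u v → v ∈ pair u v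
  ∈pairʳ u v = x∈p∪q⁺ {p = ⁅ u ⁆} (inj₂ (x∈⁅x⁆ v))

  ∈pair⁻ : ∀ u v {x} → x ∈ pair u v → x ≡ u ⊎ x ≡ v
  ∈pair⁻ u v x∈ with x∈p∪q⁻ ⁅ u ⁆ ⁅ v ⁆ x∈
  ... | inj₁ x∈u = inj₁ (x∈⁅y⁆⇒x≡y u x∈u)
  ... | inj₂ x∈v = inj₂ (x∈⁅y⁆⇒x≡y v x∈v)

  ∉pair : ∀ u v {x} → u ≢ x → v ≢ x → x ∉ pair u v
  ∉pair u v u≢x v≢x x∈ = [ u≢x ∘ sym , v≢x ∘ sym ]′ (∈pair⁻ u v x∈)

  pair⊆ : ∀ {u v S} → u ∈ S → v ∈ S → pair u v ⊆ S
  pair⊆ {u} {v} u∈S v∈S x∈ with ∈pair⁻ u v x∈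
  ... | inj₁ refl = u∈S
  ... | inj₂ refl = v∈S

  -- Without `u ≢ v` every singleton simplex would give a loop, as `pair u u` is a singleton.
  skeleton : Complex n → Graph n
  skeleton K = record
    { Adj    = λ u v → u ≢ v × Simplex K (pair u v)
    ; adj?   = λ u v → ¬? (u ≟ v) ×-dec simplex? K (pair u v)
    ; irrefl = λ (v≢v , _) → v≢v refl
    ; symm   = λ {u} {v} (u≢v , uv) →
        u≢v ∘ sym , subst (Simplex K) (∪-comm ⁅ u ⁆ ⁅ v ⁆) uv
    }

  PathConnected : Graph n → Set
  PathConnected G = ∀ u v → Star (Adj G) u v

  graphSimplex-edge : ∀ {G : Graph n} {S u v} → GraphSimplex G S → u ∈ S → v ∈ S → u ≢ v → Adj G u v
  graphSimplex-edge empty      u∈ _  _   = contradiction u∈ ∉⊥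
  graphSimplex-edge (vertex w) u∈ v∈ u≢v =
    contradiction (trans (x∈⁅y⁆⇒x≡y w u∈) (sym (x∈⁅y⁆⇒x≡y w v∈))) u≢v
  graphSimplex-edge {G} (edge {a} {b} ab) u∈ v∈ u≢v with ∈pair⁻ a b u∈ | ∈pair⁻ a b v∈
  ... | inj₁ refl | inj₁ refl = contradiction refl u≢v
  ... | inj₁ refl | inj₂ refl = ab
  ... | inj₂ refl | inj₁ refl = symm G ab
  ... | inj₂ refl | inj₂ refl = contradiction refl u≢v

  skeleton-pathConnected : ∀ K G → graphComplex G ⊆ᶜ K → PathConnected G → PathConnected (skeleton K)
  skeleton-pathConnected K G G⊆K conn u v =
    Star.map (λ ab → (λ { refl → irrefl G ab }) , G⊆K (edge ab)) (conn u v)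

  -- The set of vertices reached from u is enlarged until no edge leaves it; by
  -- connectedness it is then everything.
  connected⇒pathConnected : ∀ K → Connected K → PathConnected (skeleton K)
  connected⇒pathConnected K conn u =
    explore ⁅ u ⁆ (⊃-wellFounded ⁅ u ⁆) (x∈⁅x⁆ u)
      λ x x∈ → subst (Star (Adj (skeleton K)) u) (sym (x∈⁅y⁆⇒x≡y u x∈)) ε
    where
    explore : ∀ I₀ → Acc _⊃_ I₀ → u ∈ I₀ → (∀ x → x ∈ I₀ → Star (Adj (skeleton K)) u x) →
              ∀ v → Star (Adj (skeleton K)) u v
    explore I₀ (acc rec) u∈ reached v with
      any? (λ x → (x ∈? I₀) ×-dec any? (λ y → ¬? (y ∈? I₀) ×-dec adj? (skeleton K) x y))
    ... | yes (x , x∈ , y , y∉ , xy) =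
      explore (I₀ ∪ ⁅ y ⁆) (rec (p⊆p∪q ⁅ y ⁆ , y , x∈p∪q⁺ {p = I₀} (inj₂ (x∈⁅x⁆ y)) , y∉))
        (p⊆p∪q ⁅ y ⁆ u∈) reached′ v
      where
      reached′ : ∀ z → z ∈ I₀ ∪ ⁅ y ⁆ → Star (Adj (skeleton K)) u z
      reached′ z z∈ with x∈p∪q⁻ I₀ ⁅ y ⁆ z∈
      ... | inj₁ z∈I₀ = reached z z∈I₀
      ... | inj₂ z∈y with refl ← x∈⁅y⁆⇒x≡y y z∈y = reached x x∈ Star.◅◅ (xy ◅ ε)
    ... | no closed with v ∈? I₀
    ...   | yes v∈ = reached v v∈
    ...   | no v∉  = contradiction (I₀ , (u , u∈) , (v , x∉p⇒x∈∁p v∉) , split) conn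
      where
      split : ∀ S → Simplex K S → S ⊆ I₀ ⊎ S ⊆ ∁ I₀
      split S S∈K with any? (λ x → (x ∈? S) ×-dec (x ∈? I₀))
      ... | no disjoint = inj₂ λ {y} y∈S → x∉p⇒x∈∁p λ y∈ → disjoint (y , y∈S , y∈)
      ... | yes (x , x∈S , x∈) = inj₁ λ {y} y∈S → decidable-stable (y ∈? I₀) λ y∉ →
        closed (x , x∈ , y , y∉ , (λ { refl → y∉ x∈ }) , down K (pair⊆ x∈S y∈S) S∈K)

  -- Connectedness and generation of the even strings

  pathConnected⇒generates : ∀ K → PathConnected (skeleton K) → Generates K (Ev n)
  pathConnected⇒generates K conn =
    2 , length es , boundary es ,
    ((λ { (x , refl) → boundary-Ev es x }) , λ {y} → onto y) , simplices
    where
    es : List (Fin n × Fin n)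
    -- Each edge is listed in both orientations and so carries two inputs; both are read at its end
    -- points only, so this adds no simplices.
    es = filter (λ (u , v) → adj? (skeleton K) u v) (cartesianProduct (allFin n) (allFin n))

    edge-closed : ∀ {u v y} → Adj (skeleton K) u v → Image (boundary es) y →
                  Image (boundary es) (flip² (u , v) y)
    edge-closed {u} {v} uv (x , refl) =
      boundary-flip² (∈-filter⁺ _ (∈-cartesianProduct⁺ (∈-allFin u) (∈-allFin v)) uv) x

    -- The pair flips of consecutive edges cancel at their common vertex, which leaves the two ends
    -- of the path; on the empty path one vertex is flipped twice.
    path-closed : ∀ {u v y} → Star (Adj (skeleton K)) u v → Image (boundary es) y →
                  Image (boundary es) (flip² (u , v) y)
    path-closed {u} {y = y} ε im = subst (Image (boundary es)) (sym (flip-involutive u y)) im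
    path-closed {u} {w} {y} (_◅_ {j = v} uv vw) im =
      subst (Image (boundary es)) (cong (flip u) (flip-involutive v (flip w y)))
        (edge-closed uv (path-closed vw im))

    onto : ∀ y → Ev n y → Image (boundary es) y
    onto = flips-generate-Ev (Image (boundary es)) (_ , boundary-zeros es)
      (λ (u , v) → path-closed (conn u v))

    -- All vertices of a simplex read a common input `j`. Minimality of the windows makes them end
    -- points of edge `j`, which is a simplex of `K`.
    simplices : communicationComplex (boundary es) ⊆ᶜ K
    simplices {S} (j , j∈) = down K S⊆
      (proj₂ (proj₂ (∈-filter⁻ _ {xs = cartesianProduct (allFin n) (allFin n)} (∈-lookup {xs = es} j))))
      where
      S⊆ : S ⊆ pair (proj₁ (List.lookup es j)) (proj₂ (List.lookup es j))
      S⊆ {i} i∈S with star⇒incident es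
        (proj₂ (inputWindow-smallest (boundary es) i) (star i es) (star-determines i es) (j∈ i i∈S))
      ... | inj₁ refl = ∈pairˡ _ _
      ... | inj₂ refl = ∈pairʳ _ _

  generates⇒connected : ∀ K → Generates K (Ev n) → Connected K
  generates⇒connected K (b , m , f , (f⊆Ev , Ev⊆f) , Kf⊆K) (I₀ , (s , s∈) , (t , t∈) , split)
    with Ev⊆f {replicate n zero} (Ev-zeros n)
       | Ev⊆f {flip² (s , t) (replicate n zero)} (Ev-flip² (s , t) (replicate n zero) (Ev-zeros n))
  -- The output at `z` is zero on `I₀` and agrees with the indicator of `s` and `t` elsewhere, so
  -- its only 1 is at `t`.
  ... | x , fx | y , fy = ¬Ev-flip t (replicate n zero) (Ev-zeros n)
    (subst (Ev n) fz≡ (f⊆Ev {f z} (z , refl)))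
    where
    -- Carries the split of the outputs over to the inputs; an input that no output reads falls to
    -- `y`.
    Read : Fin m → Set
    Read j = ∃ λ i → i ∈ I₀ × j ∈ inputWindow f i

    read? : ∀ j → Dec (Read j)
    read? j = any? (λ i → (i ∈? I₀) ×-dec (j ∈? inputWindow f i))

    glue : ∀ {j} → Dec (Read j) → Fin b
    glue {j} (yes _) = lookup x j
    glue {j} (no _)  = lookup y j

    z : Vec (Fin b) m
    z = tabulate (λ j → glue (read? j))

    -- A shared input would make `pair i i′` a simplex of `K` that crosses the split.
    windows-disjoint : ∀ {i i′ j} → i ∈ I₀ → i′ ∉ I₀ → j ∈ inputWindow f i → ¬ j ∈ inputWindow f i′
    windows-disjoint {i} {i′} {j} i∈ i′∉ j∈ j∈′
      with split (pair i i′) (Kf⊆K (j , λ k k∈ →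
             [ (λ { refl → j∈ }) , (λ { refl → j∈′ }) ]′ (∈pair⁻ i i′ k∈)))
    ... | inj₁ ⊆I₀  = i′∉ (⊆I₀ (∈pairʳ i i′))
    ... | inj₂ ⊆∁I₀ = x∈∁p⇒x∉p (⊆∁I₀ (∈pairˡ i i′)) i∈

    glue-x : ∀ {i j} → i ∈ I₀ → j ∈ inputWindow f i → (d : Dec (Read j)) → glue d ≡ lookup x j
    glue-x i∈ j∈ (yes _)    = refl
    glue-x i∈ j∈ (no ¬read) = contradiction (_ , i∈ , j∈) ¬read

    glue-y : ∀ {i j} → i ∉ I₀ → j ∈ inputWindow f i → (d : Dec (Read j)) → glue d ≡ lookup y j
    glue-y i∉ j∈ (yes (_ , i′∈ , j∈′)) = contradiction j∈ (windows-disjoint i′∈ i∉ j∈′)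
    glue-y i∉ j∈ (no _)                = refl

    t∉ : t ∉ I₀
    t∉ = x∈∁p⇒x∉p t∈

    fz : ∀ i → lookup (f z) i ≡ lookup (flip t (replicate n zero)) i
    fz i with i ∈? I₀
    ... | yes i∈ = trans
      (proj₁ (inputWindow-smallest f i) z x λ j j∈ →
        trans (lookup∘tabulate _ j) (glue-x i∈ j∈ (read? j)))
      (trans (cong (λ w → lookup w i) fx)
             (sym (lookup∘updateAt′ i t (λ { refl → t∉ i∈ }) (replicate n zero))))
    ... | no i∉ = trans
      (proj₁ (inputWindow-smallest f i) z y λ j j∈ →
        trans (lookup∘tabulate _ j) (glue-y i∉ j∈ (read? j)))
      (trans (cong (λ w → lookup w i) fy)
             (lookup∘updateAt′ i s (λ { refl → i∉ s∈ }) (flip t (replicate n zero))))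

    fz≡ : f z ≡ flip t (replicate n zero)
    fz≡ = Pointwise-≡⇒≡ (ext fz)

-- Simple walks and cycles

module _ {A : Set} {R : Rel A 0ℓ} where

  -- The visited vertices, both ends included, are an index, so that `Unique` can speak of them and
  -- they can serve as a cycle.
  data Walk : A → List A → A → Set where
    [_] : ∀ v → Walk v (v ∷ []) v
    _∷_ : ∀ {u v w xs} → R u v → Walk v xs w → Walk u (u ∷ xs) w

  walk-from : ∀ {u v w xs} → Walk v xs w → Unique xs → u ∈ˡ xs → ∃ λ ys → Walk u ys w × Unique ys
  walk-from p@([ _ ]) uniq       (here refl) = _ , p , uniq
  walk-from p@(_ ∷ _) uniq       (here refl) = _ , p , uniq
  walk-from (_ ∷ p)   (_ ∷ uniq) (there u∈)  = walk-from p uniq u∈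

  -- Loop erasure: if `u` already lies on the simple walk found for the rest, only the part from `u`
  -- onwards is kept.
  simpleWalk : Decidable (_≡_ {A = A}) → ∀ {u v} → Star R u v → ∃ λ xs → Walk u xs v × Unique xs
  simpleWalk _≟_ ε = _ , [ _ ] , [] ∷ []
  simpleWalk _≟_ {u} (uw ◅ wv) with simpleWalk _≟_ wv
  ... | xs , p , uniq with ∈ˡ? _≟_ u xs
  ...   | yes u∈ = walk-from p uniq u∈
  ...   | no u∉  = u ∷ xs , uw ∷ p , ¬Any⇒All¬ xs u∉ ∷ uniq

-- There are two relations because the walk runs in a subgraph and the closing step in the whole
-- graph.
walk⇒linked : ∀ {A : Set} {R S : Rel A 0ℓ} → (∀ {x y} → R x y → S x y) →
              ∀ {u xs v w} → Walk {R = R} u xs v → S v w → Linked S (xs ∷ʳ w)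
walk⇒linked R⇒S [ _ ]             vw = vw ∷ [-]
walk⇒linked R⇒S (uv ∷ [ _ ])      vw = R⇒S uv ∷ vw ∷ [-]
walk⇒linked R⇒S (uv ∷ p@(_ ∷ _)) vw = R⇒S uv ∷ walk⇒linked R⇒S p vw

module _ {n : ℕ} where

  -- A simple walk in `H` from `u` to `v` with two or more edges would be closed to a cycle of `G`
  -- by the edge `uv`; so it is a single edge.
  acyclic⇒subgraph-edge : (G H : Graph n) → (∀ vs → ¬ IsCycle G vs) →
    (∀ {a b} → Adj H a b → Adj G a b) → ∀ {u v} → Star (Adj H) u v → Adj G u v → Adj H u v
  acyclic⇒subgraph-edge G H acyclic H⊆G path uv with simpleWalk _≟_ path
  ... | _ , [ _ ]          , _    = contradiction uv (irrefl G)
  ... | _ , uv′ ∷ [ _ ]    , _    = uv′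
  ... | _ , p@(_ ∷ _ ∷ [ _ ]) , uniq =
    contradiction (s≤s (s≤s (s≤s z≤n)) , uniq , walk⇒linked H⊆G p (symm G uv)) (acyclic _)
  ... | _ , p@(_ ∷ _ ∷ _ ∷ _) , uniq =
    contradiction (s≤s (s≤s (s≤s z≤n)) , uniq , walk⇒linked H⊆G p (symm G uv)) (acyclic _)

  _≟ˢ_ : (S T : Subset n) → Dec (S ≡ T)
  _≟ˢ_ = ≡-dec _≟ᵇ_

  -- Comparing pairs as sets removes both orientations at once.
  deleteEdge : Graph n → Fin n → Fin n → Graph n
  deleteEdge G v w = record
    { Adj    = λ a b → Adj G a b × pair a b ≢ pair v w
    ; adj?   = λ a b → adj? G a b ×-dec ¬? (pair a b ≟ˢ pair v w)
    ; irrefl = λ (aa , _) → irrefl G aa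
    ; symm   = λ {a} {b} (ab , ≢vw) → symm G ab , ≢vw ∘ trans (∪-comm ⁅ a ⁆ ⁅ b ⁆)
    }

  module _ (G : Graph n) {v w : Fin n} where

    -- A step that starts outside `pair v w` is not the deleted edge, so this stretch of the cycle
    -- back to `v` survives.
    detour : ∀ {x xs} → Linked (Adj G) (x ∷ xs ∷ʳ v) → All (_∉ pair v w) (x ∷ xs) →
             Star (Adj (deleteEdge G v w)) x v
    detour {x} {[]}    (xv ∷ _) (x∉ ∷ _) =
      (xv , λ eq → x∉ (subst (x ∈_) eq (∈pairˡ _ _))) ◅ ε
    detour {x} {_ ∷ _} (xy ∷ l) (x∉ ∷ a) =
      (xy , λ eq → x∉ (subst (x ∈_) eq (∈pairˡ _ _))) ◅ detour l a

    -- Every passage along the deleted edge is replaced by the given walk or its reverse.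
    deleteEdge-pathConnected : Star (Adj (deleteEdge G v w)) w v → PathConnected G →
                               PathConnected (deleteEdge G v w)
    deleteEdge-pathConnected w⟶v conn a b = (bypass ⋆) (conn a b)
      where
      bypass : ∀ {a b} → Adj G a b → Star (Adj (deleteEdge G v w)) a b
      bypass {a} {b} ab with pair a b ≟ˢ pair v w
      ... | no ≢vw = (ab , ≢vw) ◅ ε
      ... | yes eq with ∈pair⁻ v w (subst (a ∈_) eq (∈pairˡ a b))
                      | ∈pair⁻ v w (subst (b ∈_) eq (∈pairʳ a b))
      ...   | inj₁ refl | inj₁ refl = contradiction ab (irrefl G)
      ...   | inj₁ refl | inj₂ refl = Star.reverse (symm (deleteEdge G v w)) w⟶v
      ...   | inj₂ refl | inj₁ refl = w⟶v
      ...   | inj₂ refl | inj₂ refl = contradiction ab (irrefl G)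

  cycle-edge : ∀ (G : Graph n) vs → IsCycle G vs → PathConnected G →
               ∃ λ v → ∃ λ w → Adj G v w × PathConnected (deleteEdge G v w)
  cycle-edge G (v ∷ w ∷ x ∷ vs)
    (_ , (v≢w ∷ v≢x ∷ v≢vs) ∷ (w≢x ∷ w≢vs) ∷ _ , vw ∷ wx ∷ rest) conn =
    v , w , vw , deleteEdge-pathConnected G
      -- This step starts inside the pair; its far end `x` shows that it is not the deleted edge.
      ((wx , λ eq → x∉ (subst (x ∈_) eq (∈pairʳ _ _))) ◅
       detour G rest (x∉ ∷ All.zipWith (λ (v≢ , w≢) → ∉pair v w v≢ w≢) (v≢vs , w≢vs)))
      conn
    where
    x∉ : x ∉ pair v w
    x∉ = ∉pair v w v≢x w≢x
  cycle-edge G (v ∷ [])     (s≤s () , _)       conn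
  cycle-edge G (v ∷ w ∷ []) (s≤s (s≤s ()) , _) conn

-- Minimal generating complexes and spanning trees

distinctVertex : ∀ {n} → 2 ≤ n → (v : Fin n) → ∃ λ w → v ≢ w
distinctVertex (s≤s (s≤s _)) zero    = suc zero , λ ()
distinctVertex (s≤s (s≤s _)) (suc _) = zero , λ ()

-- For n ≤ 1 a connected complex may have no simplices at all.
skeleton⊆ : ∀ {n} → 2 ≤ n → ∀ K → PathConnected (skeleton K) → graphComplex (skeleton {n} K) ⊆ᶜ K
skeleton⊆ {n} 2≤n K conn = included
  where
  vertex∈ : ∀ v → Simplex K ⁅ v ⁆
  vertex∈ v with distinctVertex 2≤n v
  ... | w , v≢w with conn v w
  ...   | ε            = contradiction refl v≢w
  ...   | (_ , vx) ◅ _ = down K (p⊆p∪q _) vx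

  someVertex : 2 ≤ n → Fin n
  someVertex (s≤s _) = zero

  included : graphComplex (skeleton K) ⊆ᶜ K
  included empty          = down K ⊥⊆ (vertex∈ (someVertex 2≤n))
  included (vertex v)     = vertex∈ v
  included (edge (_ , uv)) = uv

minimal⇒tree : ∀ {n} → 2 ≤ n → ∀ K → MinimalGenerating K (Ev n) → IsSpanningTree K
minimal⇒tree {n} 2≤n K (gen , minimal) = G , (conn , acyclic) , K⊆G , skeleton⊆ 2≤n K conn
  where
  G : Graph n
  G = skeleton K

  conn : PathConnected G
  conn = connected⇒pathConnected K (generates⇒connected K gen)

  pathConnected-generates : ∀ H → PathConnected H → Generates (graphComplex H) (Ev n)
  pathConnected-generates H = pathConnected⇒generates (graphComplex H) ∘
    skeleton-pathConnected (graphComplex H) H (λ S∈ → S∈)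

  -- Otherwise the complex of `G`, which generates as `G` is connected, would be strictly smaller
  -- than `K`.
  K⊆G : K ⊆ᶜ graphComplex G
  K⊆G {S} S∈K = decidable-stable (simplex? (graphComplex G) S) λ S∉ →
    minimal (graphComplex G) (skeleton⊆ 2≤n K conn , λ K⊆ → S∉ (K⊆ S∈K))
      (pathConnected-generates G conn)

  acyclic : ∀ vs → ¬ IsCycle G vs
  acyclic vs cyc with cycle-edge G vs cyc conn
  ... | v , w , (v≢w , vw) , conn′ =
    minimal (graphComplex G′) ((λ S∈ → skeleton⊆ 2≤n K conn (G′⊆G S∈)) , proper)
      (pathConnected-generates G′ conn′)
    where
    G′ : Graph n
    G′ = deleteEdge G v w

    G′⊆G : graphComplex G′ ⊆ᶜ graphComplex G
    G′⊆G empty          = empty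
    G′⊆G (vertex v)     = vertex v
    G′⊆G (edge (ab , _)) = edge ab

    -- The deleted pair is a simplex of `K`, but adjacency in `G′` excludes it.
    proper : ¬ (K ⊆ᶜ graphComplex G′)
    proper K⊆ = proj₂ (graphSimplex-edge (K⊆ vw) (∈pairˡ v w) (∈pairʳ v w) v≢w) refl

-- The edges of a generating subcomplex form a connected spanning subgraph of the tree. Acyclicity
-- forces every tree edge into it, so the subcomplex is not strict.
tree⇒minimal : ∀ {n} → 2 ≤ n → ∀ K → IsSpanningTree K → MinimalGenerating K (Ev n)
tree⇒minimal {n} 2≤n K (G , (conn , acyclic) , K⊆G , G⊆K) =
  pathConnected⇒generates K (skeleton-pathConnected K G G⊆K conn) , minimal
  where
  minimal : ∀ K′ → K′ ⊂ᶜ K → ¬ Generates K′ (Ev n)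
  minimal K′ (K′⊆K , K⊈K′) gen = K⊈K′ (λ S∈ → G⊆K′ (K⊆G S∈))
    where
    H : Graph n
    H = skeleton K′

    conn′ : PathConnected H
    conn′ = connected⇒pathConnected K′ (generates⇒connected K′ gen)

    H⊆G : ∀ {a b} → Adj H a b → Adj G a b
    H⊆G {a} {b} (a≢b , ab) = graphSimplex-edge (K⊆G (K′⊆K ab)) (∈pairˡ a b) (∈pairʳ a b) a≢b

    G⊆K′ : graphComplex G ⊆ᶜ K′
    G⊆K′ empty      = skeleton⊆ 2≤n K′ conn′ empty
    G⊆K′ (vertex v) = skeleton⊆ 2≤n K′ conn′ (vertex v)
    G⊆K′ (edge uv)  = proj₂ (acyclic⇒subgraph-edge G H acyclic H⊆G (conn′ _ _) uv)

proposition3p1 : (n : ℕ) →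
    ((K : Complex n) → Generates K (Ev n) ⇔ Connected K) ×
    (2 ≤ n → (K : Complex n) → MinimalGenerating K (Ev n) ⇔ IsSpanningTree K)
proposition3p1 n =
  (λ K → mk⇔ (generates⇒connected K) (pathConnected⇒generates K ∘ connected⇒pathConnected K)) ,
  (λ 2≤n K → mk⇔ (minimal⇒tree 2≤n K) (tree⇒minimal 2≤n K))
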